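{- For all sufficiently large $n\in\mathbb N$: (1) for every function $f\colon\{0,1\}^n\to\{0,1\}$ that is not identically $0$, there exist $\epsilon\in(0,1]$ and a CNF formula of size at most $\epsilon 2^{n+3}/n$ that approximates $f$ with one-sided error and advantage $\epsilon$; (2) there exists a function $f\colon\{0,1\}^n\to\{0,1\}$ such that, for every $\epsilon\in(0,1]$, every CNF formula approximating $f$ with one-sided error and advantage $\epsilon$ has size at least $\epsilon 2^{n-7}/n$.
   Context: A CNF formula is an AND of clauses (ORs of literals); its size is its number of clauses. A CNF formula $\phi$ approximates $f$ with one-sided error and advantage $\epsilon$ if $\phi^{ -1}(1)\subseteq f^{ -1}(1)$ and $\Pr_{x\sim f^{ -1}(1)}[\phi(x)=1]\ge\epsilon$, where $x$ is uniform on $f^{ -1}(1)$. -}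

module Defs where

open import Data.Bool using (Bool; true; false; not; _∧_; _∨_)
open import Data.Nat using (ℕ; zero; suc; _^_)
open import Data.Fin using (Fin)
open import Data.Vec using (Vec; []; _∷_; lookup)
open import Data.List using (List; []; _∷_; map; _++_; length; filterᵇ)
open import Data.Bool.ListAction using (all; any)
open import Data.Product using (_×_; _,_)
open import Data.Integer using (+_)
open import Data.Rational using (ℚ; _/_; _*_; _≤_; _<_; 0ℚ; 1ℚ)
open import Relation.Binary.PropositionalEquality using (_≡_)

Input : ℕ → Set
Input n = Vec Bool n

BoolFun : ℕ → Set
BoolFun n = Input n → Bool

-- A literal: a variable index and a polarity (true = x_i, false = ¬x_i)
Literal : ℕ → Set
Literal n = Fin n × Bool

Clause : ℕ → Set
Clause n = List (Literal n)

CNF : ℕ → Set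
CNF n = List (Clause n)

size : ∀ {n} → CNF n → ℕ
size φ = length φ

evalLit : ∀ {n} → Literal n → Input n → Bool
evalLit (i , true)  x = lookup x i
evalLit (i , false) x = not (lookup x i)

evalClause : ∀ {n} → Clause n → Input n → Bool
evalClause c x = any (λ l → evalLit l x) c

evalCNF : ∀ {n} → CNF n → Input n → Bool
evalCNF φ x = all (λ c → evalClause c x) φ

allInputs : (n : ℕ) → List (Input n)
allInputs zero    = [] ∷ []
allInputs (suc n) = map (false ∷_) (allInputs n) ++ map (true ∷_) (allInputs n)

count : ∀ {n} → BoolFun n → ℕ
count {n} g = length (filterᵇ g (allInputs n))

ℕtoℚ : ℕ → ℚ
ℕtoℚ k = + k / 1

-- φ approximates f with one-sided error and advantage ε:
--   φ^{-1}(1) ⊆ f^{-1}(1)  and  Pr_{x ~ f^{-1}(1)}[φ(x)=1] ≥ ε,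
-- the latter written as  |φ^{-1}(1)| ≥ ε · |f^{-1}(1)|  (equivalent when f ≢ 0).
Approximates : ∀ {n} → BoolFun n → CNF n → ℚ → Set
Approximates {n} f φ ε =
  (∀ (x : Input n) → evalCNF φ x ≡ true → f x ≡ true)
  × (ε * ℕtoℚ (count f) ≤ ℕtoℚ (count (evalCNF φ)))

InUnitInterval : ℚ → Set
InUnitInterval ε = (0ℚ < ε) × (ε ≤ 1ℚ)

{-# OPTIONS --safe #-}

-- Upper bound: split the variables into halves (z , y) with |z| = m and |y| = k. Around a centre y₀,
-- k² binary clauses force y to differ from y₀ in at most one coordinate; then a single clause
-- "z ≠ a, or yᵢ ≠ y₀ᵢ for some i with f (a , y₀ ⊕ eᵢ) = 1" per prefix a selects exactly the points of f
-- among the k neighbours (a , y₀ ⊕ eᵢ). So O(2ᵐ) clauses handle k 2ᵐ points, and averaging over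
-- y₀ gives a centre for which f has at least its average density on these points.
--
-- Lower bound: take f (0 , x) = g x and f (1 , x) = ¬ g x with g uniformly random, so that f has
-- exactly 2ⁿ⁻¹ ones. A CNF accepting A points lies below f with probability at most 2⁻ᴬ, and there are
-- at most 2²ⁿˢ CNFs with s clauses up to equivalence, so by a union bound some f has A ≤ 64 s n for
-- every CNF below it.
module Submission where

open import Defs
open import Data.Bool using (Bool; true; false)
open import Data.Nat using (ℕ; _≥_; _+_; _∸_; _^_)
open import Data.Product using (_×_; _,_; ∃; ∃-syntax)
open import Relation.Binary.PropositionalEquality using (_≡_)
open import Relation.Nullary using (¬_)

-- Finite sums and counting on the Boolean cube.

module Counting where

  open import Data.Bool using (Bool; true; false; not; if_then_else_)
  open import Data.Fin using (Fin; zero; suc)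
  open import Data.List using (List; []; _∷_; _++_; map; length; allFin; filterᵇ; cartesianProductWith)
  open import Data.List.Properties using (length-++; length-map; map-tabulate; length-tabulate)
  open import Data.List.Membership.Propositional using (_∈_)
  open import Data.List.Membership.Propositional.Properties using (∈-map⁺; ∈-++⁺ˡ; ∈-++⁺ʳ)
  open import Data.List.Relation.Unary.Any using (here; there)
  open import Data.Nat
  open import Data.Nat.Properties
  open import Data.Nat.Tactic.RingSolver using (solve-∀)
  open import Data.Product using (∃-syntax; _,_)
  open import Data.Vec as Vec using ([]; _∷_; updateAt)
  open import Function using (_∘_; id)
  open import Relation.Binary.PropositionalEquality
  open import Relation.Nullary using (yes; no)

  ∑ : ∀ {A : Set} → List A → (A → ℕ) → ℕ
  ∑ []       h = 0
  ∑ (x ∷ xs) h = h x + ∑ xs h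

  infix 5 ∑
  syntax ∑ xs (λ x → e) = ∑[ x ∈ xs ] e

  𝟙 : Bool → ℕ
  𝟙 b = if b then 1 else 0

  module _ {A : Set} where

    ∑-cong : ∀ {g h : A → ℕ} (xs : List A) → (∀ x → g x ≡ h x) → ∑ xs g ≡ ∑ xs h
    ∑-cong []       eq = refl
    ∑-cong (x ∷ xs) eq = cong₂ _+_ (eq x) (∑-cong xs eq)

    ∑-mono : ∀ {g h : A → ℕ} (xs : List A) → (∀ x → g x ≤ h x) → ∑ xs g ≤ ∑ xs h
    ∑-mono []       le = z≤n
    ∑-mono (x ∷ xs) le = +-mono-≤ (le x) (∑-mono xs le)

    ∑-++ : ∀ (xs ys : List A) (h : A → ℕ) → ∑ (xs ++ ys) h ≡ ∑ xs h + ∑ ys h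
    ∑-++ []       ys h = refl
    ∑-++ (x ∷ xs) ys h = trans (cong (h x +_) (∑-++ xs ys h)) (sym (+-assoc (h x) _ _))

    ∑-const : ∀ (xs : List A) c → (∑[ x ∈ xs ] c) ≡ length xs * c
    ∑-const []       c = refl
    ∑-const (x ∷ xs) c = cong (c +_) (∑-const xs c)

    ∑-+ : ∀ (xs : List A) (g h : A → ℕ) → (∑[ x ∈ xs ] (g x + h x)) ≡ ∑ xs g + ∑ xs h
    ∑-+ []       g h = refl
    ∑-+ (x ∷ xs) g h = trans (cong (g x + h x +_) (∑-+ xs g h)) (interchange (g x) (h x) _ _)
      where
      interchange : ∀ a b c d → a + b + (c + d) ≡ a + c + (b + d)
      interchange = solve-∀

    ∑-*ʳ : ∀ (xs : List A) (h : A → ℕ) c → (∑[ x ∈ xs ] h x * c) ≡ ∑ xs h * c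
    ∑-*ʳ []       h c = refl
    ∑-*ʳ (x ∷ xs) h c = trans (cong (h x * c +_) (∑-*ʳ xs h c)) (sym (*-distribʳ-+ c (h x) _))

    ∑-*ˡ : ∀ (xs : List A) (h : A → ℕ) c → (∑[ x ∈ xs ] c * h x) ≡ c * ∑ xs h
    ∑-*ˡ xs h c = trans (∑-cong xs (λ x → *-comm c (h x))) (trans (∑-*ʳ xs h c) (*-comm _ c))

    ∑-bound : ∀ (xs : List A) (h : A → ℕ) c d → (∀ x → h x * c ≤ d) → ∑ xs h * c ≤ length xs * d
    ∑-bound xs h c d le = begin
      ∑ xs h * c          ≡⟨ ∑-*ʳ xs h c ⟨
      ∑[ x ∈ xs ] h x * c ≤⟨ ∑-mono xs le ⟩
      ∑[ x ∈ xs ] d       ≡⟨ ∑-const xs d ⟩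
      length xs * d       ∎
      where open ≤-Reasoning

    ∑-∈-≤ : ∀ {xs : List A} {x} (h : A → ℕ) → x ∈ xs → h x ≤ ∑ xs h
    ∑-∈-≤ {y ∷ xs} h (here refl) = m≤m+n (h y) _
    ∑-∈-≤ {y ∷ xs} h (there x∈)  = ≤-trans (∑-∈-≤ h x∈) (m≤n+m _ (h y))

    -- First-moment method: if every value were at least 1, the sum would reach the length.
    ∑<length⇒∃0 : ∀ (xs : List A) (h : A → ℕ) → ∑ xs h < length xs → ∃[ x ] h x ≡ 0
    ∑<length⇒∃0 (x ∷ xs) h lt with h x in eq
    ... | zero  = x , eq
    ... | suc k = ∑<length⇒∃0 xs h (≤-trans (s≤s (m≤n+m _ k)) (s≤s⁻¹ lt))

    pigeonhole-≥ : ∀ (xs : List A) (h : A → ℕ) c → 0 < length xs → length xs * c ≤ ∑ xs h → ∃[ x ] c ≤ h x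
    pigeonhole-≥ (x ∷ xs) h c _ le with c ≤? h x
    ... | yes c≤ = x , c≤
    pigeonhole-≥ (x ∷ []) h c _ le | no c≰ =
      x , subst₂ _≤_ (+-identityʳ c) (+-identityʳ (h x)) le
    pigeonhole-≥ (x ∷ xs@(_ ∷ _)) h c _ le | no c≰ =
      pigeonhole-≥ xs h c z<s (+-cancelˡ-≤ c _ _ (≤-trans le (+-monoˡ-≤ _ (≰⇒≥ c≰))))

    length-filterᵇ : ∀ (p : A → Bool) xs → length (filterᵇ p xs) ≡ ∑[ x ∈ xs ] 𝟙 (p x)
    length-filterᵇ p []       = refl
    length-filterᵇ p (x ∷ xs) with p x
    ... | true  = cong suc (length-filterᵇ p xs)
    ... | false = length-filterᵇ p xs

  module _ {A B : Set} where

    ∑-map : ∀ (f : A → B) xs (h : B → ℕ) → ∑ (map f xs) h ≡ ∑ xs (h ∘ f)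
    ∑-map f []       h = refl
    ∑-map f (x ∷ xs) h = cong (h (f x) +_) (∑-map f xs h)

    ∑-swap : ∀ (xs : List A) (ys : List B) (h : A → B → ℕ) →
             (∑[ x ∈ xs ] ∑[ y ∈ ys ] h x y) ≡ (∑[ y ∈ ys ] ∑[ x ∈ xs ] h x y)
    ∑-swap []       ys h = sym (trans (∑-const ys 0) (*-zeroʳ (length ys)))
    ∑-swap (x ∷ xs) ys h =
      trans (cong (∑ ys (h x) +_) (∑-swap xs ys h)) (sym (∑-+ ys (h x) _))

  module _ {A B C : Set} (f : A → B → C) where

    length-cartesianProductWith : ∀ xs ys → length (cartesianProductWith f xs ys) ≡ length xs * length ys
    length-cartesianProductWith []       ys = refl
    length-cartesianProductWith (x ∷ xs) ys =
      trans (length-++ (map (f x) ys))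
            (cong₂ _+_ (length-map (f x) ys) (length-cartesianProductWith xs ys))

    ∑-cartesianProductWith : ∀ xs ys (h : C → ℕ) →
      ∑ (cartesianProductWith f xs ys) h ≡ ∑[ x ∈ xs ] ∑[ y ∈ ys ] h (f x y)
    ∑-cartesianProductWith []       ys h = refl
    ∑-cartesianProductWith (x ∷ xs) ys h =
      trans (∑-++ (map (f x) ys) _ h)
            (cong₂ _+_ (∑-map (f x) ys h) (∑-cartesianProductWith xs ys h))

  allFin-suc : ∀ n → allFin (suc n) ≡ zero ∷ map suc (allFin n)
  allFin-suc n = cong (zero ∷_) (sym (map-tabulate id suc))

  length-allFin : ∀ n → length (allFin n) ≡ n
  length-allFin n = length-tabulate id

  ∑-inputs-suc : ∀ n (h : Input (suc n) → ℕ) →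
    ∑ (allInputs (suc n)) h ≡ (∑[ x ∈ allInputs n ] h (false ∷ x)) + (∑[ x ∈ allInputs n ] h (true ∷ x))
  ∑-inputs-suc n h =
    trans (∑-++ (map (false ∷_) (allInputs n)) _ h)
          (cong₂ _+_ (∑-map (false ∷_) (allInputs n) h) (∑-map (true ∷_) (allInputs n) h))

  ∑-inputs-++ : ∀ m k (h : Input (m + k) → ℕ) →
    ∑ (allInputs (m + k)) h ≡ ∑[ a ∈ allInputs m ] ∑[ y ∈ allInputs k ] h (a Vec.++ y)
  ∑-inputs-++ zero    k h = sym (+-identityʳ _)
  ∑-inputs-++ (suc m) k h = begin
    ∑ (allInputs (suc m + k)) h
      ≡⟨ ∑-inputs-suc (m + k) h ⟩
    ∑ (allInputs (m + k)) (h ∘ (false ∷_)) + ∑ (allInputs (m + k)) (h ∘ (true ∷_))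
      ≡⟨ cong₂ _+_ (∑-inputs-++ m k _) (∑-inputs-++ m k _) ⟩
    (∑[ a ∈ allInputs m ] ∑[ y ∈ allInputs k ] h (false ∷ (a Vec.++ y)))
      + (∑[ a ∈ allInputs m ] ∑[ y ∈ allInputs k ] h (true ∷ (a Vec.++ y)))
      ≡⟨ ∑-inputs-suc m _ ⟨
    (∑[ a ∈ allInputs (suc m) ] ∑[ y ∈ allInputs k ] h (a Vec.++ y)) ∎
    where open ≡-Reasoning

  length-allInputs : ∀ n → length (allInputs n) ≡ 2 ^ n
  length-allInputs zero    = refl
  length-allInputs (suc n) = begin
    length (map (false ∷_) (allInputs n) ++ map (true ∷_) (allInputs n))
      ≡⟨ length-++ (map (false ∷_) (allInputs n)) ⟩
    length (map (false ∷_) (allInputs n)) + length (map (true ∷_) (allInputs n))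
      ≡⟨ cong₂ _+_ (trans (length-map (false ∷_) (allInputs n)) (length-allInputs n))
                   (trans (length-map (true ∷_) (allInputs n)) (length-allInputs n)) ⟩
    2 ^ n + 2 ^ n
      ≡⟨ cong (2 ^ n +_) (+-identityʳ (2 ^ n)) ⟨
    2 ^ suc n ∎
    where open ≡-Reasoning

  count≡∑ : ∀ {n} (g : BoolFun n) → count g ≡ ∑[ x ∈ allInputs n ] 𝟙 (g x)
  count≡∑ {n} g = length-filterᵇ g (allInputs n)

  𝟙≤1 : ∀ b → 𝟙 b ≤ 1
  𝟙≤1 true  = ≤-refl
  𝟙≤1 false = z≤n

  𝟙-mono : ∀ {b c} → (b ≡ true → c ≡ true) → 𝟙 b ≤ 𝟙 c
  𝟙-mono {false} _   = z≤n
  𝟙-mono {true}  b⇒c = ≤-reflexive (cong 𝟙 (sym (b⇒c refl)))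

  count-mono : ∀ {n} {g h : BoolFun n} → (∀ x → g x ≡ true → h x ≡ true) → count g ≤ count h
  count-mono {n} {g} {h} g⇒h = subst₂ _≤_ (sym (count≡∑ g)) (sym (count≡∑ h))
    (∑-mono (allInputs n) (λ x → 𝟙-mono (g⇒h x)))

  count≤2^n : ∀ {n} (g : BoolFun n) → count g ≤ 2 ^ n
  count≤2^n {n} g = begin
    count g                        ≡⟨ count≡∑ g ⟩
    ∑[ x ∈ allInputs n ] 𝟙 (g x)   ≤⟨ ∑-mono (allInputs n) (λ x → 𝟙≤1 (g x)) ⟩
    ∑[ x ∈ allInputs n ] 1         ≡⟨ ∑-const (allInputs n) 1 ⟩
    length (allInputs n) * 1       ≡⟨ *-identityʳ _ ⟩
    length (allInputs n)           ≡⟨ length-allInputs n ⟩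
    2 ^ n                          ∎
    where open ≤-Reasoning

  ∈-allInputs : ∀ {n} (x : Input n) → x ∈ allInputs n
  ∈-allInputs []          = here refl
  ∈-allInputs (false ∷ x) = ∈-++⁺ˡ (∈-map⁺ (false ∷_) (∈-allInputs x))
  ∈-allInputs (true ∷ x)  = ∈-++⁺ʳ _ (∈-map⁺ (true ∷_) (∈-allInputs x))

  count≡0⇒≡false : ∀ {n} (g : BoolFun n) → count g ≡ 0 → ∀ x → g x ≡ false
  count≡0⇒≡false {n} g eq x
    with g x | ≤-trans (∑-∈-≤ (𝟙 ∘ g) (∈-allInputs x)) (≤-reflexive (trans (sym (count≡∑ g)) eq))
  ... | false | _ = refl

  flip : ∀ {n} → Input n → Fin n → Input n
  flip x i = updateAt x i not

  -- A flip permutes the cube: at coordinate `zero` it swaps the two half-cubes, elsewhere it acts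
  -- inside each of them.
  ∑-flip : ∀ {n} (i : Fin n) (h : Input n → ℕ) → (∑[ x ∈ allInputs n ] h (flip x i)) ≡ ∑ (allInputs n) h
  ∑-flip {suc n} zero h = begin
    (∑[ x ∈ allInputs (suc n) ] h (flip x zero))
      ≡⟨ ∑-inputs-suc n _ ⟩
    (∑[ x ∈ allInputs n ] h (true ∷ x)) + (∑[ x ∈ allInputs n ] h (false ∷ x))
      ≡⟨ +-comm _ (∑ (allInputs n) (h ∘ (false ∷_))) ⟩
    (∑[ x ∈ allInputs n ] h (false ∷ x)) + (∑[ x ∈ allInputs n ] h (true ∷ x))
      ≡⟨ ∑-inputs-suc n h ⟨
    ∑ (allInputs (suc n)) h ∎
    where open ≡-Reasoning
  ∑-flip {suc n} (suc i) h =
    trans (∑-inputs-suc n _)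
          (trans (cong₂ _+_ (∑-flip i (h ∘ (false ∷_))) (∑-flip i (h ∘ (true ∷_)))) (sym (∑-inputs-suc n h)))

  -- The neighbours of a point are pairwise distinct: flipping the head leads to the opposite
  -- half-cube, every other flip stays in the half of `b`.
  ∑-neighbours≤∑ : ∀ {n} (y : Input n) (h : Input n → ℕ) →
    (∑[ i ∈ allFin n ] h (flip y i)) ≤ ∑ (allInputs n) h
  ∑-neighbours≤∑ []              h = z≤n
  ∑-neighbours≤∑ {suc n} (b ∷ y) h = begin
    ∑[ i ∈ allFin (suc n) ] h (flip (b ∷ y) i)
      ≡⟨ cong (λ is → ∑ is (λ i → h (flip (b ∷ y) i))) (allFin-suc n) ⟩
    h (not b ∷ y) + (∑[ i ∈ map suc (allFin n) ] h (flip (b ∷ y) i))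
      ≡⟨ cong (h (not b ∷ y) +_) (∑-map suc (allFin n) _) ⟩
    h (not b ∷ y) + (∑[ i ∈ allFin n ] h (b ∷ flip y i))
      ≤⟨ +-mono-≤ (∑-∈-≤ (h ∘ (not b ∷_)) (∈-allInputs y)) (∑-neighbours≤∑ y (h ∘ (b ∷_))) ⟩
    ∑ (allInputs n) (h ∘ (not b ∷_)) + ∑ (allInputs n) (h ∘ (b ∷_))
      ≡⟨ both b ⟩
    ∑ (allInputs n) (h ∘ (false ∷_)) + ∑ (allInputs n) (h ∘ (true ∷_))
      ≡⟨ ∑-inputs-suc n h ⟨
    ∑ (allInputs (suc n)) h ∎
    where
    open ≤-Reasoning
    both : ∀ b → ∑ (allInputs n) (h ∘ (not b ∷_)) + ∑ (allInputs n) (h ∘ (b ∷_))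
               ≡ ∑ (allInputs n) (h ∘ (false ∷_)) + ∑ (allInputs n) (h ∘ (true ∷_))
    both true  = refl
    both false = +-comm (∑ (allInputs n) (h ∘ (true ∷_))) _

  -- Double counting: for each fixed direction `i`, the points `flip y i` run through the cube
  -- exactly once.
  ∑-∑-neighbours : ∀ n (h : Input n → ℕ) →
    (∑[ y ∈ allInputs n ] ∑[ i ∈ allFin n ] h (flip y i)) ≡ n * ∑ (allInputs n) h
  ∑-∑-neighbours n h = begin
    (∑[ y ∈ allInputs n ] ∑[ i ∈ allFin n ] h (flip y i)) ≡⟨ ∑-swap (allInputs n) (allFin n) _ ⟩
    (∑[ i ∈ allFin n ] ∑[ y ∈ allInputs n ] h (flip y i)) ≡⟨ ∑-cong (allFin n) (λ i → ∑-flip i h) ⟩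
    (∑[ i ∈ allFin n ] ∑ (allInputs n) h)                 ≡⟨ ∑-const (allFin n) _ ⟩
    length (allFin n) * ∑ (allInputs n) h                 ≡⟨ cong (_* ∑ (allInputs n) h) (length-allFin n) ⟩
    n * ∑ (allInputs n) h                                 ∎
    where open ≡-Reasoning

-- Boolean evaluation expressed by literals that hold.

module Semantics where

  open import Data.Bool using (true; false; T)
  open import Data.Bool.Properties using (T-≡)
  open import Data.List.Relation.Unary.All using (All)
  open import Data.List.Relation.Unary.All.Properties using (all⁺; all⁻)
  open import Data.List.Relation.Unary.Any using (Any)
  open import Data.List.Relation.Unary.Any.Properties using (any⁺; any⁻)
  open import Data.Product using (_,_)
  open import Data.Vec using (lookup)
  open import Function using (_∘_; Equivalence)
  open import Relation.Binary.PropositionalEquality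
  import Data.List.Relation.Unary.All as All
  import Data.List.Relation.Unary.Any as Any

  Holds : ∀ {n} → Input n → Literal n → Set
  Holds x (i , b) = lookup x i ≡ b

  Holds⇒T : ∀ {n} {x : Input n} l → Holds x l → T (evalLit l x)
  Holds⇒T {x = x} (i , true)  eq rewrite eq = _
  Holds⇒T {x = x} (i , false) eq rewrite eq = _

  T⇒Holds : ∀ {n} {x : Input n} l → T (evalLit l x) → Holds x l
  T⇒Holds {x = x} (i , true)  t with lookup x i
  ... | true  = refl
  T⇒Holds {x = x} (i , false) t with lookup x i
  ... | false = refl

  clause⁺ : ∀ {n} {c : Clause n} {x} → Any (Holds x) c → T (evalClause c x)
  clause⁺ = any⁺ _ ∘ Any.map (λ {l} → Holds⇒T l)

  clause⁻ : ∀ {n} {c : Clause n} {x} → T (evalClause c x) → Any (Holds x) c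
  clause⁻ = Any.map (λ {l} → T⇒Holds l) ∘ any⁻ _ _

  cnf⁺ : ∀ {n} {φ : CNF n} {x} → All (Any (Holds x)) φ → evalCNF φ x ≡ true
  cnf⁺ = Equivalence.to T-≡ ∘ all⁻ _ ∘ All.map clause⁺

  cnf⁻ : ∀ {n} {φ : CNF n} {x} → evalCNF φ x ≡ true → All (Any (Holds x)) φ
  cnf⁻ = All.map clause⁻ ∘ all⁺ _ _ ∘ Equivalence.from T-≡

-- Upper bound: formulas selecting neighbours of a centre.

module UpperBound where

  open Counting
  open Semantics
  open import Data.Bool using (true; not)
  open import Data.Bool.Properties using (not-¬; ¬-not) renaming (_≟_ to _≟ᵇ_)
  open import Data.Fin using (Fin; _↑ˡ_; _↑ʳ_)
  open import Data.Fin.Properties using (_≟_; ¬∀⟶∃¬)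
  open import Data.List using (List; []; _∷_; _++_; map; length; allFin; filter; cartesianProduct)
  open import Data.List.Properties using (length-++; length-map; length-filter)
  open import Data.List.Membership.Propositional using (_∈_; find; lose)
  open import Data.List.Membership.Propositional.Properties
  open import Data.List.Relation.Unary.Any using (Any; here; there)
  import Data.List.Relation.Unary.All as All
  import Data.List.Relation.Unary.Any.Properties as Any
  open import Data.Nat hiding (_≟_)
  open import Data.Nat.Properties hiding (_≟_)
  open import Data.Nat.Tactic.RingSolver using (solve-∀)
  open import Data.Product using (_×_; _,_; ∃-syntax)
  open import Data.Sum using (inj₁; inj₂)
  open import Data.Vec as Vec using (lookup)
  open import Data.Vec.Properties using (lookup-++ˡ; lookup-++ʳ; lookup∘updateAt; lookup∘updateAt′; tabulate∘lookup; tabulate-cong; ≡-dec)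
  open import Function using (_∘_)
  open import Relation.Binary.PropositionalEquality
  open import Relation.Nullary using (¬?; yes; no; contradiction)

  lookup-ext : ∀ {n} {x y : Input n} → (∀ i → lookup x i ≡ lookup y i) → x ≡ y
  lookup-ext {x = x} {y} eq =
    trans (sym (tabulate∘lookup x)) (trans (tabulate-cong eq) (tabulate∘lookup y))

  module Construction (m k : ℕ) (f : BoolFun (m + k)) (y : Input k) where

    distinctPairs : List (Fin k × Fin k)
    distinctPairs = filter (λ (i , j) → ¬? (i ≟ j)) (cartesianProduct (allFin k) (allFin k))

    pairClause : Fin k × Fin k → Clause (m + k)
    pairClause (i , j) = (m ↑ʳ i , lookup y i) ∷ (m ↑ʳ j , lookup y j) ∷ []

    goodDirections : Input m → List (Fin k)
    goodDirections a = filter (λ i → f (a Vec.++ flip y i) ≟ᵇ true) (allFin k)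

    prefixLiterals : Input m → Clause (m + k)
    prefixLiterals a = map (λ i → i ↑ˡ k , not (lookup a i)) (allFin m)

    directionLiterals : Input m → Clause (m + k)
    directionLiterals a = map (λ i → m ↑ʳ i , not (lookup y i)) (goodDirections a)

    columnClause : Input m → Clause (m + k)
    columnClause a = prefixLiterals a ++ directionLiterals a

    neighbourCNF : CNF (m + k)
    neighbourCNF = map pairClause distinctPairs ++ map columnClause (allInputs m)

    size-neighbourCNF : size neighbourCNF ≤ k * k + 2 ^ m
    size-neighbourCNF = begin
      length (map pairClause distinctPairs ++ map columnClause (allInputs m))
        ≡⟨ length-++ (map pairClause distinctPairs) ⟩
      length (map pairClause distinctPairs) + length (map columnClause (allInputs m))
        ≡⟨ cong₂ _+_ (length-map pairClause distinctPairs)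
                     (trans (length-map columnClause (allInputs m)) (length-allInputs m)) ⟩
      length distinctPairs + 2 ^ m
        ≤⟨ +-monoˡ-≤ (2 ^ m) (length-filter _ (cartesianProduct (allFin k) (allFin k))) ⟩
      length (cartesianProduct (allFin k) (allFin k)) + 2 ^ m
        ≡⟨ cong (_+ 2 ^ m) (trans (length-cartesianProductWith _,_ (allFin k) (allFin k))
                                  (cong₂ _*_ (length-allFin k) (length-allFin k))) ⟩
      k * k + 2 ^ m ∎
      where open ≤-Reasoning

    -- At prefix `a` all prefix literals of `columnClause a` fail, so `z` differs from `y` in some
    -- good direction `i`; the pair clauses then pin every other suffix coordinate to `y`.
    sound : ∀ x → evalCNF neighbourCNF x ≡ true → f x ≡ true
    sound x sat with Vec.splitAt m x
    ... | a , z , refl with cnf⁻ sat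
    ... | clauses with Any.++⁻ (prefixLiterals a)
                         (All.lookup clauses (∈-++⁺ʳ _ (∈-map⁺ columnClause (∈-allInputs a))))
    ... | inj₁ any with find (Any.map⁻ any)
    ...   | i , _ , eq = contradiction (trans (sym (lookup-++ˡ a z i)) eq) (not-¬ refl)
    sound x sat | a , z , refl | clauses | inj₂ any with find (Any.map⁻ any)
    ...   | i , i∈ , eq with ∈-filter⁻ (λ i → f (a Vec.++ flip y i) ≟ᵇ true) {xs = allFin k} i∈
    ...     | _ , fi = trans (cong (λ w → f (a Vec.++ w)) (lookup-ext z≗flip)) fi
      where
      zᵢ : lookup z i ≡ not (lookup y i)
      zᵢ = trans (sym (lookup-++ʳ a z i)) eq
      z≗flip : ∀ j → lookup z j ≡ lookup (flip y i) j
      z≗flip j with i ≟ j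
      ... | yes refl = trans zᵢ (sym (lookup∘updateAt i y))
      -- Since `z` differs from `y` at `i`, the clause of the pair (`i`, `j`) can hold only through
      -- `j`.
      ... | no  i≢j with All.lookup clauses (∈-++⁺ˡ (∈-map⁺ pairClause
                           (∈-filter⁺ (λ (i , j) → ¬? (i ≟ j))
                             (∈-cartesianProduct⁺ (∈-allFin i) (∈-allFin j)) i≢j)))
      ...   | here e         = contradiction (trans (sym (trans (sym (lookup-++ʳ a z i)) e)) zᵢ) (not-¬ refl)
      ...   | there (here e) = trans (sym (lookup-++ʳ a z j)) (trans e (sym (lookup∘updateAt′ j i (i≢j ∘ sym) y)))

    -- Of two distinct indices at most one is the flipped `i`, so pair clauses hold. The column
    -- clause of `a` holds by its direction literal for `i`, that of any other prefix by a
    -- coordinate where the prefixes differ.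
    complete : ∀ a i → f (a Vec.++ flip y i) ≡ true → evalCNF neighbourCNF (a Vec.++ flip y i) ≡ true
    complete a i fi = cnf⁺ (All.tabulate λ c∈ → holds (∈-++⁻ (map pairClause distinctPairs) c∈))
      where
      x = a Vec.++ flip y i
      unflipped : ∀ j → j ≢ i → lookup x (m ↑ʳ j) ≡ lookup y j
      unflipped j j≢i = trans (lookup-++ʳ a (flip y i) j) (lookup∘updateAt′ j i j≢i y)
      column : ∀ a′ → Any (Holds x) (columnClause a′)
      column a′ with ≡-dec _≟ᵇ_ a a′
      ... | yes refl = Any.++⁺ʳ (prefixLiterals a) (Any.map⁺ (lose
                         (∈-filter⁺ (λ i → f (a Vec.++ flip y i) ≟ᵇ true) (∈-allFin i) fi)
                         (trans (lookup-++ʳ a (flip y i) i) (lookup∘updateAt i y))))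
      ... | no  a≢a′ with ¬∀⟶∃¬ m _ (λ j → lookup a j ≟ᵇ lookup a′ j) (a≢a′ ∘ lookup-ext)
      ...   | j , aⱼ≢ = Any.++⁺ˡ (Any.map⁺ (lose (∈-allFin j) (trans (lookup-++ˡ a (flip y i) j) (¬-not aⱼ≢))))
      holds : ∀ {c} → _ → Any (Holds x) c
      holds (inj₁ c∈) with ∈-map⁻ pairClause c∈
      ... | (j , j′) , p∈ , refl with ∈-filter⁻ (λ (i , j) → ¬? (i ≟ j)) {xs = cartesianProduct (allFin k) (allFin k)} p∈
      ... | _ , j≢j′ with j ≟ i
      ...   | no  j≢i  = here (unflipped j j≢i)
      ...   | yes refl = there (here (unflipped j′ (j≢j′ ∘ sym)))
      holds (inj₂ c∈) with ∈-map⁻ columnClause c∈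
      ... | a′ , _ , refl = column a′

    -- The direction is the outer sum, so that `good-centre` can read this as column sums added over
    -- the neighbours of `y`.
    neighbourCount : ℕ
    neighbourCount = ∑[ i ∈ allFin k ] ∑[ a ∈ allInputs m ] 𝟙 (f (a Vec.++ flip y i))

    neighbourCount≤count : neighbourCount ≤ count (evalCNF neighbourCNF)
    neighbourCount≤count = begin
      neighbourCount
        ≡⟨ ∑-swap (allFin k) (allInputs m) _ ⟩
      ∑[ a ∈ allInputs m ] ∑[ i ∈ allFin k ] 𝟙 (f (a Vec.++ flip y i))
        ≤⟨ ∑-mono (allInputs m) (λ a → ∑-mono (allFin k) λ i → 𝟙-mono (complete a i)) ⟩
      ∑[ a ∈ allInputs m ] ∑[ i ∈ allFin k ] 𝟙 (g (a Vec.++ flip y i))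
        ≤⟨ ∑-mono (allInputs m) (λ a → ∑-neighbours≤∑ y (λ z → 𝟙 (g (a Vec.++ z)))) ⟩
      ∑[ a ∈ allInputs m ] ∑[ z ∈ allInputs k ] 𝟙 (g (a Vec.++ z))
        ≡⟨ ∑-inputs-++ m k (𝟙 ∘ g) ⟨
      ∑ (allInputs (m + k)) (𝟙 ∘ g)
        ≡⟨ count≡∑ g ⟨
      count g ∎
      where
      open ≤-Reasoning
      g = evalCNF neighbourCNF

  open Construction

  -- Over all `2 ^ k` centres the neighbour counts add up to exactly `k * count f`, and some centre
  -- reaches the average. The factor `2 ^ k` avoids a division.
  good-centre : ∀ m k (f : BoolFun (m + k)) → ∃[ y ] k * count f ≤ neighbourCount m k f y * 2 ^ k
  good-centre m k f = pigeonhole-≥ (allInputs k) (λ y → neighbourCount m k f y * 2 ^ k) (k * count f)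
    (subst (0 <_) (sym (length-allInputs k)) (m^n>0 2 k))
    (≤-reflexive (begin
      length (allInputs k) * (k * count f)
        ≡⟨ cong₂ _*_ (length-allInputs k) (cong (k *_) total) ⟩
      2 ^ k * (k * ∑ (allInputs k) columnSum)
        ≡⟨ *-comm (2 ^ k) _ ⟩
      k * ∑ (allInputs k) columnSum * 2 ^ k
        ≡⟨ cong (_* 2 ^ k) (∑-∑-neighbours k columnSum) ⟨
      ∑ (allInputs k) (neighbourCount m k f) * 2 ^ k
        ≡⟨ ∑-*ʳ (allInputs k) (neighbourCount m k f) (2 ^ k) ⟨
      ∑[ y ∈ allInputs k ] neighbourCount m k f y * 2 ^ k ∎))
    where
    open ≡-Reasoning
    columnSum : Input k → ℕ
    columnSum z = ∑[ a ∈ allInputs m ] 𝟙 (f (a Vec.++ z))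
    total : count f ≡ ∑ (allInputs k) columnSum
    total = trans (count≡∑ f) (trans (∑-inputs-++ m k (𝟙 ∘ f)) (∑-swap (allInputs m) (allInputs k) _))

  2m+3≤3*2^m : ∀ m → 2 * m + 3 ≤ 3 * 2 ^ m
  2m+3≤3*2^m zero    = ≤-refl
  2m+3≤3*2^m (suc m) = begin
    2 * suc m + 3         ≡⟨ lhs m ⟩
    2 * m + 3 + 2         ≤⟨ +-mono-≤ (2m+3≤3*2^m m) (≤-trans (n≤1+n 2) (*-monoʳ-≤ 3 (m^n>0 2 m))) ⟩
    3 * 2 ^ m + 3 * 2 ^ m ≡⟨ rhs (2 ^ m) ⟩
    3 * 2 ^ suc m         ∎
    where
    open ≤-Reasoning
    lhs : ∀ m → 2 * suc m + 3 ≡ 2 * m + 3 + 2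
    lhs = solve-∀
    rhs : ∀ p → 3 * p + 3 * p ≡ 3 * (2 * p)
    rhs = solve-∀

  -- Absorbs the pair clauses: with the `2 ^ m` column clauses the size is at most `4 * 2 ^ m`, and
  -- `n ≤ 2 * k` turns this 4 into the 8 of `2 ^ (n + 3)`. The induction adds the increment
  -- `2 * m + 3` of consecutive squares.
  [1+m]²≤3*2^m : ∀ m → suc m * suc m ≤ 3 * 2 ^ m
  [1+m]²≤3*2^m zero    = s≤s z≤n
  [1+m]²≤3*2^m (suc m) = begin
    suc (suc m) * suc (suc m)       ≡⟨ lhs m ⟩
    suc m * suc m + (2 * m + 3)     ≤⟨ +-mono-≤ ([1+m]²≤3*2^m m) (2m+3≤3*2^m m) ⟩
    3 * 2 ^ m + 3 * 2 ^ m           ≡⟨ rhs (2 ^ m) ⟩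
    3 * 2 ^ suc m                   ∎
    where
    open ≤-Reasoning
    lhs : ∀ m → suc (suc m) * suc (suc m) ≡ suc m * suc m + (2 * m + 3)
    lhs = solve-∀
    rhs : ∀ p → 3 * p + 3 * p ≡ 3 * (2 * p)
    rhs = solve-∀

  -- The claim for `ε = count (evalCNF φ) / count f` with denominators cleared; the positive count
  -- will give `0 < ε`.
  DenseCNF : ∀ {n} → BoolFun n → Set
  DenseCNF {n} f = ∃[ φ ] (∀ x → evalCNF φ x ≡ true → f x ≡ true)
    × 0 < count (evalCNF φ)
    × size φ * n * count f ≤ count (evalCNF φ) * 2 ^ (n + 3)

  -- Balancing the halves serves both estimates: `m ≤ k` gives `n ≤ 2 * k`, and `k ≤ suc m` keeps
  -- the `k * k` pair clauses within `3 * 2 ^ m`.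
  denseCNF-halves : ∀ m k → m ≤ k → k ≤ suc m → 0 < k →
    (f : BoolFun (m + k)) → 0 < count f → DenseCNF f
  denseCNF-halves m k m≤k k≤1+m 0<k f 0<f with good-centre m k f
  ... | y , kF≤N2ᵏ = neighbourCNF m k f y , sound m k f y , positive , bound
    where
    open ≤-Reasoning
    s = size (neighbourCNF m k f y)
    A = count (evalCNF (neighbourCNF m k f y))
    F = count f
    kF≤A2ᵏ : k * F ≤ A * 2 ^ k
    kF≤A2ᵏ = ≤-trans kF≤N2ᵏ (*-monoˡ-≤ (2 ^ k) (neighbourCount≤count m k f y))
    positive : 0 < A
    positive = n≢0⇒n>0 λ A≡0 →
      <⇒≱ (*-mono-< 0<k 0<f) (subst (λ a → k * F ≤ a * 2 ^ k) A≡0 kF≤A2ᵏ)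
    s≤4*2ᵐ : s ≤ 4 * 2 ^ m
    s≤4*2ᵐ = begin
      s                      ≤⟨ size-neighbourCNF m k f y ⟩
      k * k + 2 ^ m          ≤⟨ +-monoˡ-≤ (2 ^ m) (*-mono-≤ k≤1+m k≤1+m) ⟩
      suc m * suc m + 2 ^ m  ≤⟨ +-monoˡ-≤ (2 ^ m) ([1+m]²≤3*2^m m) ⟩
      3 * 2 ^ m + 2 ^ m      ≡⟨ +-comm (3 * 2 ^ m) (2 ^ m) ⟩
      4 * 2 ^ m              ∎
    regroup : ∀ p k F → 4 * p * (k + k) * F ≡ 8 * p * (k * F)
    regroup = solve-∀
    regroup′ : ∀ p A q → 8 * p * (A * q) ≡ A * (p * q * 8)
    regroup′ = solve-∀
    bound : s * (m + k) * F ≤ A * 2 ^ (m + k + 3)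
    bound = begin
      s * (m + k) * F              ≤⟨ *-monoˡ-≤ F (*-mono-≤ s≤4*2ᵐ (+-monoˡ-≤ k m≤k)) ⟩
      4 * 2 ^ m * (k + k) * F      ≡⟨ regroup (2 ^ m) k F ⟩
      8 * 2 ^ m * (k * F)          ≤⟨ *-monoʳ-≤ (8 * 2 ^ m) kF≤A2ᵏ ⟩
      8 * 2 ^ m * (A * 2 ^ k)      ≡⟨ regroup′ (2 ^ m) A (2 ^ k) ⟩
      A * (2 ^ m * 2 ^ k * 8)      ≡⟨ cong (λ p → A * (p * 8)) (^-distribˡ-+-* 2 m k) ⟨
      A * (2 ^ (m + k) * 8)        ≡⟨ cong (A *_) (^-distribˡ-+-* 2 (m + k) 3) ⟨
      A * 2 ^ (m + k + 3)          ∎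

  denseCNF : ∀ n → 0 < n → (f : BoolFun n) → 0 < count f → DenseCNF f
  denseCNF n 0<n = subst (λ n → (f : BoolFun n) → 0 < count f → DenseCNF f) (⌊n/2⌋+⌈n/2⌉≡n n)
    -- `⌈ n /2⌉` is `⌊ suc n /2⌋` and `suc ⌊ n /2⌋` is `⌊ suc (suc n) /2⌋`, so monotonicity yields
    -- `k ≤ suc m`.
    (denseCNF-halves ⌊ n /2⌋ ⌈ n /2⌉ (⌊n/2⌋≤⌈n/2⌉ n) (⌊n/2⌋-mono (s≤s (n≤1+n n))) (⌈n/2⌉-mono 0<n))

-- Lower bound by the probabilistic method.

module LowerBound where

  open Counting
  open Semantics
  open import Data.Bool using (Bool; true; false; not; _∧_)
  open import Data.Bool.Properties using (T-≡; ⇔→≡) renaming (_≟_ to _≟ᵇ_)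
  open import Data.Fin.Properties using () renaming (_≟_ to _≟ᶠ_)
  open import Data.List using (List; []; _∷_; _++_; map; length; allFin; filter; cartesianProduct; cartesianProductWith; upTo)
  open import Data.List.Properties using (length-++; length-map; length-upTo)
  open import Data.List.Membership.Propositional using (_∈_; find; lose)
  open import Data.List.Membership.Propositional.Properties
  open import Data.List.Relation.Unary.Any using (here; there)
  open import Data.Nat
  open import Data.Nat.Properties
  open import Data.Nat.Tactic.RingSolver using (solve-∀)
  open import Data.Product using (_,_; ∃-syntax; proj₂)
  open import Data.Product.Properties using () renaming (≡-dec to ×-≡-dec)
  open import Data.Vec using ([]; _∷_; replicate)
  open import Function using (_∘_; mk⇔; Equivalence)
  open import Relation.Binary.PropositionalEquality
  open import Relation.Nullary using (does; contradiction)
  open import Relation.Unary using (Decidable)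

  -- Enumeration of formulas up to equivalence.

  literals : ∀ n → List (Literal n)
  literals n = cartesianProduct (allFin n) (true ∷ false ∷ [])

  ∈-literals : ∀ {n} (l : Literal n) → l ∈ literals n
  ∈-literals (i , true)  = ∈-cartesianProduct⁺ (∈-allFin i) (here refl)
  ∈-literals (i , false) = ∈-cartesianProduct⁺ (∈-allFin i) (there (here refl))

  sublists : ∀ {A : Set} → List A → List (List A)
  sublists []       = [] ∷ []
  sublists (x ∷ xs) = map (x ∷_) (sublists xs) ++ sublists xs

  length-sublists : ∀ {A : Set} (xs : List A) → length (sublists xs) ≡ 2 ^ length xs
  length-sublists []       = refl
  length-sublists (x ∷ xs) = begin
    length (map (x ∷_) (sublists xs) ++ sublists xs)
      ≡⟨ length-++ (map (x ∷_) (sublists xs)) ⟩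
    length (map (x ∷_) (sublists xs)) + length (sublists xs)
      ≡⟨ cong₂ _+_ (trans (length-map (x ∷_) (sublists xs)) (length-sublists xs)) (length-sublists xs) ⟩
    2 ^ length xs + 2 ^ length xs
      ≡⟨ cong (2 ^ length xs +_) (+-identityʳ (2 ^ length xs)) ⟨
    2 ^ length (x ∷ xs) ∎
    where open ≡-Reasoning

  filter∈sublists : ∀ {A : Set} {P : A → Set} (P? : Decidable P) xs → filter P? xs ∈ sublists xs
  filter∈sublists P? []       = here refl
  filter∈sublists P? (x ∷ xs) with does (P? x)
  ... | true  = ∈-++⁺ˡ (∈-map⁺ (x ∷_) (filter∈sublists P? xs))
  ... | false = ∈-++⁺ʳ _ (filter∈sublists P? xs)

  module _ {n : ℕ} where

    open import Data.List.Membership.DecPropositional (×-≡-dec (_≟ᶠ_ {n}) _≟ᵇ_) using (_∈?_)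

    -- Clauses are arbitrary lists, hence unbounded in number; filtering the fixed list of literals
    -- forgets order and repetition and leaves `2 ^ (n * 2)` candidates.
    normalise : Clause n → Clause n
    normalise c = filter (_∈? c) (literals n)

    eval-normalise : ∀ c x → evalClause (normalise c) x ≡ evalClause c x
    eval-normalise c x = ⇔→≡ (mk⇔ (transport to) (transport from))
      where
      transport : ∀ {c d : Clause n} → (∀ {l} → l ∈ c → l ∈ d) → evalClause c x ≡ true → evalClause d x ≡ true
      transport c⊆d sat with find (clause⁻ (Equivalence.from T-≡ sat))
      ... | l , l∈c , holds = Equivalence.to T-≡ (clause⁺ (lose (c⊆d l∈c) holds))
      to : ∀ {l} → l ∈ normalise c → l ∈ c
      to l∈ = proj₂ (∈-filter⁻ (_∈? c) {xs = literals n} l∈)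
      from : ∀ {l} → l ∈ c → l ∈ normalise c
      from l∈c = ∈-filter⁺ (_∈? c) (∈-literals _) l∈c

    normalise∈sublists : ∀ c → normalise c ∈ sublists (literals n)
    normalise∈sublists c = filter∈sublists (_∈? c) (literals n)

    eval-map-normalise : ∀ φ x → evalCNF (map normalise φ) x ≡ evalCNF φ x
    eval-map-normalise []      x = refl
    eval-map-normalise (c ∷ φ) x = cong₂ _∧_ (eval-normalise c x) (eval-map-normalise φ x)

  -- Only the clauses are put in normal form, not the list of them, so normalisation preserves the
  -- size exactly.
  normalCNFs : ∀ n → ℕ → List (CNF n)
  normalCNFs n zero    = [] ∷ []
  normalCNFs n (suc s) = cartesianProductWith _∷_ (sublists (literals n)) (normalCNFs n s)

  map-normalise∈normalCNFs : ∀ {n} (φ : CNF n) → map normalise φ ∈ normalCNFs n (size φ)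
  map-normalise∈normalCNFs []      = here refl
  map-normalise∈normalCNFs (c ∷ φ) =
    ∈-cartesianProductWith⁺ _∷_ (normalise∈sublists c) (map-normalise∈normalCNFs φ)

  length-normalCNFs : ∀ n s → length (normalCNFs n s) ≡ 2 ^ (s * (n * 2))
  length-normalCNFs n zero    = refl
  length-normalCNFs n (suc s) = begin
    length (cartesianProductWith _∷_ (sublists (literals n)) (normalCNFs n s))
      ≡⟨ length-cartesianProductWith _∷_ (sublists (literals n)) (normalCNFs n s) ⟩
    length (sublists (literals n)) * length (normalCNFs n s)
      ≡⟨ cong₂ _*_ (trans (length-sublists (literals n)) (cong (2 ^_) length-literals)) (length-normalCNFs n s) ⟩
    2 ^ (n * 2) * 2 ^ (s * (n * 2))
      ≡⟨ ^-distribˡ-+-* 2 (n * 2) (s * (n * 2)) ⟨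
    2 ^ (suc s * (n * 2)) ∎
    where
    open ≡-Reasoning
    length-literals : length (literals n) ≡ n * 2
    length-literals = trans (length-cartesianProductWith _,_ (allFin n) _) (cong (_* 2) (length-allFin n))

  -- Random functions and product weights.

  join : ∀ {n} → BoolFun n → BoolFun n → BoolFun (suc n)
  join g h (false ∷ x) = g x
  join g h (true ∷ x)  = h x

  -- The sample space: a sum over this list is `length (allFuns n)` times an expectation over
  -- uniform `g`. Joining all pairs makes the values on the two half-cubes independent.
  allFuns : ∀ n → List (BoolFun n)
  allFuns zero    = (λ _ → false) ∷ (λ _ → true) ∷ []
  allFuns (suc n) = cartesianProductWith join (allFuns n) (allFuns n)

  length-allFuns>0 : ∀ n → 0 < length (allFuns n)
  length-allFuns>0 zero    = z<s
  length-allFuns>0 (suc n) =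
    subst (0 <_) (sym (length-cartesianProductWith join (allFuns n) (allFuns n)))
          (*-mono-< (length-allFuns>0 n) (length-allFuns>0 n))

  -- Splits along the first coordinate as `join` does, so the weight of `join g h` computes to the
  -- product of the weights of `g` and `h`.
  ∏ : ∀ {n} → (Input n → ℕ) → ℕ
  ∏ {zero}  h = h []
  ∏ {suc n} h = ∏ (h ∘ (false ∷_)) * ∏ (h ∘ (true ∷_))

  ∏≡1 : ∀ {n} (h : Input n → ℕ) → (∀ x → h x ≡ 1) → ∏ h ≡ 1
  ∏≡1 {zero}  h eq = eq []
  ∏≡1 {suc n} h eq = cong₂ _*_ (∏≡1 _ (eq ∘ (false ∷_))) (∏≡1 _ (eq ∘ (true ∷_)))

  weight : ∀ {n} → (Input n → Bool → ℕ) → BoolFun n → ℕ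
  weight w g = ∏ λ x → w x (g x)

  -- For independent uniform values of g the expected weight factors over the points.
  ∑-weight-bound : ∀ {n} (w : Input n → Bool → ℕ) (c : Input n → ℕ) →
    (∀ x → (w x false + w x true) * 2 ^ c x ≤ 2) →
    ∑ (allFuns n) (weight w) * 2 ^ ∑ (allInputs n) c ≤ length (allFuns n)
  ∑-weight-bound {zero} w c le =
    subst₂ (λ a b → a * 2 ^ b ≤ 2) (cong (w [] false +_) (sym (+-identityʳ (w [] true))))
           (sym (+-identityʳ (c []))) (le [])
  ∑-weight-bound {suc n} w c le = begin
    ∑ (allFuns (suc n)) (weight w) * 2 ^ ∑ (allInputs (suc n)) c
      ≡⟨ cong₂ (λ a b → a * 2 ^ b) split (∑-inputs-suc n c) ⟩
    W₀ * W₁ * 2 ^ (C₀ + C₁)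
      ≡⟨ cong (W₀ * W₁ *_) (^-distribˡ-+-* 2 C₀ C₁) ⟩
    W₀ * W₁ * (2 ^ C₀ * 2 ^ C₁)
      ≡⟨ [m*n]*[o*p]≡[m*o]*[n*p] W₀ W₁ (2 ^ C₀) (2 ^ C₁) ⟩
    W₀ * 2 ^ C₀ * (W₁ * 2 ^ C₁)
      ≤⟨ *-mono-≤ (∑-weight-bound w₀ _ (le ∘ (false ∷_))) (∑-weight-bound w₁ _ (le ∘ (true ∷_))) ⟩
    length (allFuns n) * length (allFuns n)
      ≡⟨ length-cartesianProductWith join (allFuns n) (allFuns n) ⟨
    length (allFuns (suc n)) ∎
    where
    open ≤-Reasoning
    w₀ = w ∘ (false ∷_)
    w₁ = w ∘ (true ∷_)
    W₀ = ∑ (allFuns n) (weight w₀)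
    W₁ = ∑ (allFuns n) (weight w₁)
    C₀ = ∑ (allInputs n) (c ∘ (false ∷_))
    C₁ = ∑ (allInputs n) (c ∘ (true ∷_))
    split : ∑ (allFuns (suc n)) (weight w) ≡ W₀ * W₁
    split = trans (∑-cartesianProductWith join (allFuns n) (allFuns n) (weight w))
      (trans (∑-cong (allFuns n) (λ g → ∑-*ˡ (allFuns n) (weight w₁) (weight w₀ g)))
             (∑-*ʳ (allFuns n) (weight w₀) W₁))

  -- Balanced functions and the probability of containing a given set.

  balanced : ∀ {n} → BoolFun n → BoolFun (suc n)
  balanced g = join g (not ∘ g)

  count-balanced : ∀ {n} (g : BoolFun n) → count (balanced g) ≡ 2 ^ n
  count-balanced {n} g = begin
    count (balanced g)
      ≡⟨ count≡∑ (balanced g) ⟩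
    ∑ (allInputs (suc n)) (𝟙 ∘ balanced g)
      ≡⟨ ∑-inputs-suc n _ ⟩
    ∑ (allInputs n) (𝟙 ∘ g) + ∑ (allInputs n) (𝟙 ∘ not ∘ g)
      ≡⟨ ∑-+ (allInputs n) (𝟙 ∘ g) (𝟙 ∘ not ∘ g) ⟨
    ∑[ x ∈ allInputs n ] (𝟙 (g x) + 𝟙 (not (g x)))
      ≡⟨ ∑-cong (allInputs n) (λ x → one (g x)) ⟩
    ∑[ x ∈ allInputs n ] 1
      ≡⟨ ∑-const (allInputs n) 1 ⟩
    length (allInputs n) * 1
      ≡⟨ trans (*-identityʳ _) (length-allInputs n) ⟩
    2 ^ n ∎
    where
    open ≡-Reasoning
    one : ∀ b → 𝟙 b + 𝟙 (not b) ≡ 1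
    one true  = refl
    one false = refl

  implies : Bool → Bool → ℕ
  implies true  b = 𝟙 b
  implies false b = 1

  implies≡1 : ∀ {p b} → (p ≡ true → b ≡ true) → implies p b ≡ 1
  implies≡1 {false} _   = refl
  implies≡1 {true}  p⇒b = cong 𝟙 (p⇒b refl)

  -- The points `false ∷ x` and `true ∷ x` constrain the same bit `g x`; grouping them keeps the
  -- factors for different `x` independent.
  consistent : ∀ {n} → BoolFun (suc n) → Input n → Bool → ℕ
  consistent p x b = implies (p (false ∷ x)) b * implies (p (true ∷ x)) (not b)

  -- The indicator of the event p⁻¹(1) ⊆ (balanced g)⁻¹(1), as a product over the points of g.
  below : ∀ {n} → BoolFun (suc n) → BoolFun n → ℕ
  below p = weight (consistent p)

  below≡1 : ∀ {n} (p : BoolFun (suc n)) g → (∀ x → p x ≡ true → balanced g x ≡ true) → below p g ≡ 1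
  below≡1 p g p⇒g = ∏≡1 _ λ x → cong₂ _*_ (implies≡1 (p⇒g (false ∷ x))) (implies≡1 (p⇒g (true ∷ x)))

  -- If `p` accepts one of the two points over `x`, half of the choices for `g x` survive; if it
  -- accepts both, none does. Each accepted point thus costs at least a factor 2.
  ∑-below-bound : ∀ {n} (p : BoolFun (suc n)) → ∑ (allFuns n) (below p) * 2 ^ count p ≤ length (allFuns n)
  ∑-below-bound {n} p = subst (λ e → ∑ (allFuns n) (below p) * 2 ^ e ≤ length (allFuns n)) (sym count≡)
    (∑-weight-bound (consistent p) _ λ x → pointwise (p (false ∷ x)) (p (true ∷ x)))
    where
    count≡ : count p ≡ ∑[ x ∈ allInputs n ] (𝟙 (p (false ∷ x)) + 𝟙 (p (true ∷ x)))
    count≡ = trans (count≡∑ p) (trans (∑-inputs-suc n _) (sym (∑-+ (allInputs n) _ _)))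
    pointwise : ∀ a b → (implies a false * implies b true + implies a true * implies b false)
                          * 2 ^ (𝟙 a + 𝟙 b) ≤ 2
    pointwise true  true  = z≤n
    pointwise true  false = ≤-refl
    pointwise false true  = ≤-refl
    pointwise false false = ≤-refl

  -- The union bound over formulas and sizes.

  module _ (n K : ℕ) (4≤K : 4 ≤ K) where

    private
      N = suc n

    dense : ℕ → CNF N → Bool
    dense s φ = K * (s * N) <ᵇ count (evalCNF φ)

    failure : ℕ → CNF N → BoolFun n → ℕ
    failure s φ g = 𝟙 (dense s φ) * below (evalCNF φ) g

    -- A dense formula accepts more than `K * (s * N)` points, so `∑-below-bound` gives an even
    -- larger exponent; any other formula contributes zero.
    ∑-failure-bound : ∀ s φ → ∑ (allFuns n) (failure s φ) * 2 ^ (K * (s * N)) ≤ length (allFuns n)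
    ∑-failure-bound s φ = ≤-trans
      (≤-reflexive (cong (_* 2 ^ (K * (s * N))) (∑-*ˡ (allFuns n) (below (evalCNF φ)) (𝟙 (dense s φ)))))
      (bound (dense s φ) refl)
      where
      B = ∑ (allFuns n) (below (evalCNF φ))
      bound : ∀ b → dense s φ ≡ b → 𝟙 b * B * 2 ^ (K * (s * N)) ≤ length (allFuns n)
      bound false _  = z≤n
      bound true  eq = ≤-trans
        (*-mono-≤ (≤-reflexive (*-identityˡ B))
                  (^-monoʳ-≤ 2 (<⇒≤ (<ᵇ⇒< (K * (s * N)) (count (evalCNF φ)) (Equivalence.from T-≡ eq)))))
        (∑-below-bound (evalCNF φ))

    failures : ℕ → BoolFun n → ℕ
    failures s g = ∑[ φ ∈ normalCNFs N s ] failure s φ g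

    -- Union bound over the `2 ^ (s * (N * 2))` normal formulas of size `s = suc i`: the surplus in
    -- the exponent leaves at most `1 / 2 ^ suc N` for each size.
    ∑-failures-bound : ∀ i → ∑ (allFuns n) (failures (suc i)) * 2 ^ suc N ≤ length (allFuns n)
    ∑-failures-bound i = *-cancelˡ-≤ (2 ^ (s * (N * 2))) {{m^n≢0 2 (s * (N * 2))}} (begin
      2 ^ (s * (N * 2)) * (X * 2 ^ suc N)
        ≡⟨ swap (2 ^ (s * (N * 2))) X (2 ^ suc N) ⟩
      X * (2 ^ (s * (N * 2)) * 2 ^ suc N)
        ≡⟨ cong (X *_) (^-distribˡ-+-* 2 (s * (N * 2)) (suc N)) ⟨
      X * 2 ^ (s * (N * 2) + suc N)
        ≤⟨ *-monoʳ-≤ X (^-monoʳ-≤ 2 exponent) ⟩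
      X * 2 ^ (K * (s * N))
        ≡⟨ cong (_* 2 ^ (K * (s * N))) (∑-swap (allFuns n) (normalCNFs N s) _) ⟩
      (∑[ φ ∈ normalCNFs N s ] ∑ (allFuns n) (failure s φ)) * 2 ^ (K * (s * N))
        ≤⟨ ∑-bound (normalCNFs N s) _ _ _ (∑-failure-bound s) ⟩
      length (normalCNFs N s) * length (allFuns n)
        ≡⟨ cong (_* length (allFuns n)) (length-normalCNFs N s) ⟩
      2 ^ (s * (N * 2)) * length (allFuns n) ∎)
      where
      open ≤-Reasoning
      s = suc i
      X = ∑ (allFuns n) (failures s)
      swap : ∀ a b c → a * (b * c) ≡ b * (a * c)
      swap = solve-∀
      -- Source of `4 ≤ K`: as `s` and `N` are at least 1, doubling the exponent `s * (N * 2)` also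
      -- pays for `suc N`. The last summand is the slack.
      split : ∀ i n → 4 * (suc i * suc n) ≡ suc i * (suc n * 2) + suc (suc n) + (n + 2 * (i * suc n))
      split = solve-∀
      exponent : s * (N * 2) + suc N ≤ K * (s * N)
      exponent = begin
        s * (N * 2) + suc N   ≤⟨ m≤m+n _ _ ⟩
        s * (N * 2) + suc N + (n + 2 * (i * N)) ≡⟨ split i n ⟨
        4 * (s * N)           ≤⟨ *-monoˡ-≤ (s * N) 4≤K ⟩
        K * (s * N)           ∎

    -- Over all `2 ^ N` sizes the expected number of failures is at most one half, so some `g` has
    -- none.
    hardFunction : ∃[ g ] (∑[ i ∈ upTo (2 ^ N) ] failures (suc i) g) ≡ 0
    hardFunction = ∑<length⇒∃0 (allFuns n) _
      (half< X (length-allFuns>0 n) (*-cancelˡ-≤ (2 ^ N) {{m^n≢0 2 N}} (begin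
        2 ^ N * (2 * X)
          ≡⟨ rearrange (2 ^ N) X ⟩
        X * 2 ^ suc N
          ≡⟨ cong (_* 2 ^ suc N) (∑-swap (allFuns n) (upTo (2 ^ N)) _) ⟩
        (∑[ i ∈ upTo (2 ^ N) ] ∑ (allFuns n) (failures (suc i))) * 2 ^ suc N
          ≤⟨ ∑-bound (upTo (2 ^ N)) _ _ _ ∑-failures-bound ⟩
        length (upTo (2 ^ N)) * length (allFuns n)
          ≡⟨ cong (_* length (allFuns n)) (length-upTo (2 ^ N)) ⟩
        2 ^ N * length (allFuns n) ∎)))
      where
      open ≤-Reasoning
      X = ∑[ g ∈ allFuns n ] ∑[ i ∈ upTo (2 ^ N) ] failures (suc i) g
      rearrange : ∀ p x → p * (2 * x) ≡ x * (2 * p)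
      rearrange = solve-∀
      half< : ∀ x {t} → 0 < t → 2 * x ≤ t → x < t
      half< zero    0<t _  = 0<t
      half< (suc x) _   le = <-≤-trans (m<m+n (suc x) z<s) le

    -- A nonempty formula violating the bound has size at most `2 ^ N`, because it cannot accept
    -- more than `2 ^ N` points; its normal form would then be one of the failures that
    -- `hardFunction` excludes.
    hard : ∃[ g ] ∀ (φ : CNF N) → (∀ x → evalCNF φ x ≡ true → balanced g x ≡ true) →
           count (evalCNF φ) ≤ K * (size φ * N)
    hard with hardFunction
    ... | g , none = g , small
      where
      small : ∀ φ → (∀ x → evalCNF φ x ≡ true → balanced g x ≡ true) →
              count (evalCNF φ) ≤ K * (size φ * N)
      -- The empty formula accepts everything, whereas `balanced g` takes opposite values at the two
      -- points over any `x`.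
      small []      φ⇒f with g (replicate n false) | φ⇒f (false ∷ replicate n false) refl | φ⇒f (true ∷ replicate n false) refl
      ... | true | _ | ()
      small φ@(_ ∷ φ₀) φ⇒f = ≮⇒≥ λ lt → contradiction (failure≡1 lt) (failure≢1 lt)
        where
        s = size φ
        ψ = map normalise φ
        ψ≗φ : ∀ x → evalCNF ψ x ≡ evalCNF φ x
        ψ≗φ = eval-map-normalise φ
        countψ : count (evalCNF ψ) ≡ count (evalCNF φ)
        countψ = ≤-antisym (count-mono λ x → trans (sym (ψ≗φ x))) (count-mono λ x → trans (ψ≗φ x))
        failure≡1 : K * (s * N) < count (evalCNF φ) → failure s ψ g ≡ 1
        failure≡1 lt = cong₂ (λ b w → 𝟙 b * w)
          (Equivalence.to T-≡ (<⇒<ᵇ (subst (K * (s * N) <_) (sym countψ) lt)))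
          (below≡1 (evalCNF ψ) g (λ x sat → φ⇒f x (trans (sym (ψ≗φ x)) sat)))
        s≤2ᴺ : K * (s * N) < count (evalCNF φ) → s ≤ 2 ^ N
        s≤2ᴺ lt = begin
          s                  ≤⟨ m≤m*n s N ⟩
          s * N              ≤⟨ m≤n*m (s * N) K {{>-nonZero (<-≤-trans z<s 4≤K)}} ⟩
          K * (s * N)       ≤⟨ <⇒≤ lt ⟩
          count (evalCNF φ)  ≤⟨ count≤2^n (evalCNF φ) ⟩
          2 ^ N              ∎
          where open ≤-Reasoning
        failure≢1 : K * (s * N) < count (evalCNF φ) → failure s ψ g ≢ 1
        failure≢1 lt eq = contradiction
          (begin
            1                                          ≡⟨ eq ⟨
            failure s ψ g                              ≤⟨ ∑-∈-≤ (λ χ → failure s χ g) (map-normalise∈normalCNFs φ) ⟩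
            -- The index is `size φ₀`, one less than `s`, so `s ≤ 2 ^ N` is exactly its membership
            -- in `upTo (2 ^ N)`.
            failures s g                               ≤⟨ ∑-∈-≤ (λ i → failures (suc i) g) (∈-upTo⁺ (s≤2ᴺ lt)) ⟩
            (∑[ i ∈ upTo (2 ^ N) ] failures (suc i) g) ≡⟨ none ⟩
            0                                          ∎)
          λ ()
          where open ≤-Reasoning

-- From bounds on natural numbers to rational advantages.

open Counting
open UpperBound
open LowerBound
open import Data.Bool using (not)
open import Data.Integer as ℤ using (+_)
import Data.Integer.Properties as ℤ
open import Data.Nat as ℕ using (suc; z≤n; s≤s)
import Data.Nat.Properties as ℕ
open import Data.Rational using (ℚ; _*_; _≤_; _/_; 1ℚ; Positive; fromℚᵘ; toℚᵘ)
open import Data.Rational.Properties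
open import Data.Rational.Unnormalised as ℚᵘ using (mkℚᵘ; *≡*; *≤*)
import Data.Rational.Unnormalised.Properties as ℚᵘ
open import Data.Vec using (_∷_; replicate)
open import Relation.Binary.PropositionalEquality using (refl; sym; trans; cong)

-- Both `ℕtoℚ` and `_/_` normalise their fractions; products are compared in the unnormalised
-- rationals, where multiplication acts on numerators and denominators directly.
fromℚᵘ-* : ∀ p q → fromℚᵘ p * fromℚᵘ q ≡ fromℚᵘ (p ℚᵘ.* q)
fromℚᵘ-* p q = toℚᵘ-injective (begin-equality
  toℚᵘ (fromℚᵘ p * fromℚᵘ q)             ≃⟨ toℚᵘ-homo-* (fromℚᵘ p) (fromℚᵘ q) ⟩
  toℚᵘ (fromℚᵘ p) ℚᵘ.* toℚᵘ (fromℚᵘ q)   ≃⟨ ℚᵘ.*-cong (toℚᵘ-fromℚᵘ p) (toℚᵘ-fromℚᵘ q) ⟩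
  p ℚᵘ.* q                               ≃⟨ toℚᵘ-fromℚᵘ (p ℚᵘ.* q) ⟨
  toℚᵘ (fromℚᵘ (p ℚᵘ.* q))               ∎)
  where open ℚᵘ.≤-Reasoning

ℕtoℚ-* : ∀ a b → ℕtoℚ (a ℕ.* b) ≡ ℕtoℚ a * ℕtoℚ b
ℕtoℚ-* a b = trans (cong (_/ 1) (ℤ.pos-* a b)) (sym (fromℚᵘ-* (mkℚᵘ (+ a) 0) (mkℚᵘ (+ b) 0)))

ℕtoℚ-mono : ∀ {a b} → a ℕ.≤ b → ℕtoℚ a ≤ ℕtoℚ b
ℕtoℚ-mono {a} {b} a≤b = toℚᵘ-cancel-≤ (begin
  toℚᵘ (ℕtoℚ a)  ≃⟨ toℚᵘ-fromℚᵘ (mkℚᵘ (+ a) 0) ⟩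
  mkℚᵘ (+ a) 0   ≤⟨ *≤* (ℤ.*-monoʳ-≤-nonNeg (+ 1) (ℤ.+≤+ a≤b)) ⟩
  mkℚᵘ (+ b) 0   ≃⟨ toℚᵘ-fromℚᵘ (mkℚᵘ (+ b) 0) ⟨
  toℚᵘ (ℕtoℚ b)  ∎)
  where open ℚᵘ.≤-Reasoning

ℕtoℚ-pos : ∀ a .{{_ : ℕ.NonZero a}} → Positive (ℕtoℚ a)
ℕtoℚ-pos a = normalize-pos a 1

a/b*b≡a : ∀ a b .{{_ : ℕ.NonZero b}} → (+ a / b) * ℕtoℚ b ≡ ℕtoℚ a
a/b*b≡a a b@(suc d) = trans (fromℚᵘ-* (mkℚᵘ (+ a) d) (mkℚᵘ (+ b) 0))
  (fromℚᵘ-cong {mkℚᵘ (+ a) d ℚᵘ.* mkℚᵘ (+ b) 0} {mkℚᵘ (+ a) 0} (*≡* (trans (ℤ.*-assoc (+ a) (+ b) (+ 1)) (cong (+ a ℤ.*_) (ℤ.pos-* b 1)))))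

module Ratio (A F : ℕ) (0<A : 0 ℕ.< A) (A≤F : A ℕ.≤ F) where

  instance
    A≢0 : ℕ.NonZero A
    A≢0 = ℕ.>-nonZero 0<A
    F≢0 : ℕ.NonZero F
    F≢0 = ℕ.>-nonZero (ℕ.<-≤-trans 0<A A≤F)
    F>0 : Positive (ℕtoℚ F)
    F>0 = ℕtoℚ-pos F

  -- The exact advantage of a formula accepting `A` of the `F` ones of a function, hence the largest
  -- admissible ε.
  ratio : ℚ
  ratio = + A / F

  ratio∈[0,1] : InUnitInterval ratio
  ratio∈[0,1] = positive⁻¹ ratio {{normalize-pos A F}} , *-cancelʳ-≤-pos (ℕtoℚ F) (begin
    ratio * ℕtoℚ F  ≡⟨ a/b*b≡a A F ⟩
    ℕtoℚ A          ≤⟨ ℕtoℚ-mono A≤F ⟩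
    ℕtoℚ F          ≡⟨ *-identityˡ (ℕtoℚ F) ⟨
    1ℚ * ℕtoℚ F     ∎)
    where open ≤-Reasoning

  ratio*F≤A : ratio * ℕtoℚ F ≤ ℕtoℚ A
  ratio*F≤A = ≤-reflexive (a/b*b≡a A F)

  -- Multiplying by `F`, the denominator of `ratio`, turns this into the bound on natural numbers.
  ≤-ratio : ∀ s n P → s ℕ.* n ℕ.* F ℕ.≤ A ℕ.* P → ℕtoℚ s * ℕtoℚ n ≤ ratio * ℕtoℚ P
  ≤-ratio s n P bound = *-cancelʳ-≤-pos (ℕtoℚ F) (begin
    ℕtoℚ s * ℕtoℚ n * ℕtoℚ F     ≡⟨ cong (_* ℕtoℚ F) (ℕtoℚ-* s n) ⟨
    ℕtoℚ (s ℕ.* n) * ℕtoℚ F      ≡⟨ ℕtoℚ-* (s ℕ.* n) F ⟨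
    ℕtoℚ (s ℕ.* n ℕ.* F)         ≤⟨ ℕtoℚ-mono bound ⟩
    ℕtoℚ (A ℕ.* P)               ≡⟨ ℕtoℚ-* A P ⟩
    ℕtoℚ A * ℕtoℚ P              ≡⟨ cong (_* ℕtoℚ P) (a/b*b≡a A F) ⟨
    ratio * ℕtoℚ F * ℕtoℚ P      ≡⟨ *-assoc ratio (ℕtoℚ F) (ℕtoℚ P) ⟩
    ratio * (ℕtoℚ F * ℕtoℚ P)    ≡⟨ cong (ratio *_) (*-comm (ℕtoℚ F) (ℕtoℚ P)) ⟩
    ratio * (ℕtoℚ P * ℕtoℚ F)    ≡⟨ *-assoc ratio (ℕtoℚ P) (ℕtoℚ F) ⟨
    ratio * ℕtoℚ P * ℕtoℚ F      ∎)
    where open ≤-Reasoning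

approximation : ∀ n → 0 ℕ.< n → (f : BoolFun n) → ¬ (∀ x → f x ≡ false) →
  ∃[ ε ] ∃[ φ ] (InUnitInterval ε × Approximates f φ ε
    × ℕtoℚ (size φ) * ℕtoℚ n ≤ ε * ℕtoℚ (2 ^ (n + 3)))
approximation n 0<n f f≢0 =
  let φ , φ⇒f , 0<A , bound = denseCNF n 0<n f (ℕ.n≢0⇒n>0 (λ F≡0 → f≢0 (count≡0⇒≡false f F≡0)))
      open Ratio (count (evalCNF φ)) (count f) 0<A (count-mono φ⇒f)
  in ratio , φ , ratio∈[0,1] , (φ⇒f , ratio*F≤A) , ≤-ratio (size φ) n (2 ^ (n + 3)) bound

-- Since `F ≡ P * K`, the factor `K` cancels from `ε * F ≤ A ≤ K * (s * n)`.
advantage-bound : ∀ (ε : ℚ) F A P s n K .{{_ : ℕ.NonZero K}} → F ≡ P ℕ.* K → A ℕ.≤ K ℕ.* (s ℕ.* n) →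
  ε * ℕtoℚ F ≤ ℕtoℚ A → ε * ℕtoℚ P ≤ ℕtoℚ s * ℕtoℚ n
advantage-bound ε F A P s n K F≡PK A≤Ksn εF≤A = *-cancelʳ-≤-pos (ℕtoℚ K) {{ℕtoℚ-pos K}} (begin
  ε * ℕtoℚ P * ℕtoℚ K        ≡⟨ *-assoc ε (ℕtoℚ P) (ℕtoℚ K) ⟩
  ε * (ℕtoℚ P * ℕtoℚ K)      ≡⟨ cong (ε *_) (trans (cong ℕtoℚ F≡PK) (ℕtoℚ-* P K)) ⟨
  ε * ℕtoℚ F                 ≤⟨ εF≤A ⟩
  ℕtoℚ A                     ≤⟨ ℕtoℚ-mono A≤Ksn ⟩
  ℕtoℚ (K ℕ.* (s ℕ.* n))     ≡⟨ cong ℕtoℚ (ℕ.*-comm K (s ℕ.* n)) ⟩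
  ℕtoℚ (s ℕ.* n ℕ.* K)       ≡⟨ ℕtoℚ-* (s ℕ.* n) K ⟩
  ℕtoℚ (s ℕ.* n) * ℕtoℚ K    ≡⟨ cong (_* ℕtoℚ K) (ℕtoℚ-* s n) ⟩
  ℕtoℚ s * ℕtoℚ n * ℕtoℚ K   ∎)
  where open ≤-Reasoning

-- Uses `hard` with `K = 2 ^ j`: `2 ≤ j` gives `4 ≤ K`, and `j ≤ n` lets the `2 ^ n` ones be written
-- as `2 ^ (n ∸ j) * 2 ^ j`.
hardness : ∀ n j → 2 ℕ.≤ j → j ℕ.≤ n → ∃[ f ] ((∃[ x ] f x ≡ true) ×
  ((ε : ℚ) → (φ : CNF (suc n)) → InUnitInterval ε → Approximates f φ ε →
    ε * ℕtoℚ (2 ^ (n ∸ j)) ≤ ℕtoℚ (size φ) * ℕtoℚ (suc n)))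
hardness n j 2≤j j≤n =
  let g , small = hard n (2 ^ j) (ℕ.^-monoʳ-≤ 2 2≤j) in
  balanced g , witness g (g (replicate n false)) refl ,
  λ ε φ _ (φ⇒f , advantage) →
    advantage-bound ε (count (balanced g)) (count (evalCNF φ)) (2 ^ (n ∸ j)) (size φ) (suc n) (2 ^ j)
      {{ℕ.m^n≢0 2 j}} (count≡ g) (small φ φ⇒f) advantage
  where
  witness : ∀ g b → g (replicate n false) ≡ b → ∃[ x ] balanced g x ≡ true
  witness g true  eq = false ∷ replicate n false , eq
  witness g false eq = true ∷ replicate n false , cong not eq
  count≡ : ∀ g → count (balanced g) ≡ 2 ^ (n ∸ j) ℕ.* 2 ^ j
  count≡ g = trans (count-balanced g)
    (trans (cong (2 ^_) (sym (ℕ.m∸n+n≡m j≤n))) (ℕ.^-distribˡ-+-* 2 (n ∸ j) j))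

theorem5p1 : ∃[ N ] ∀ (n : ℕ) → n ≥ N →
    ((f : BoolFun n) → ¬ (∀ (x : Input n) → f x ≡ false) →
    ∃[ ε ] ∃[ φ ] (InUnitInterval ε × Approximates f φ ε
    × ℕtoℚ (size φ) * ℕtoℚ n ≤ ε * ℕtoℚ (2 ^ (n + 3))))
    × (∃[ f ] ((∃[ x ] f x ≡ true) ×
    ((ε : ℚ) → (φ : CNF n) → InUnitInterval ε → Approximates f φ ε →
    ε * ℕtoℚ (2 ^ (n ∸ 7)) ≤ ℕtoℚ (size φ) * ℕtoℚ n)))
-- With `suc n` variables, `suc n ∸ 7` computes to `n ∸ 6`, hence `j = 6` and `K = 64`; the
-- threshold 7 ensures `6 ≤ n`, so the subtraction does not truncate.
theorem5p1 = 7 , λ { (suc n) (s≤s 6≤n) →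
  approximation (suc n) ℕ.z<s , hardness n 6 (s≤s (s≤s z≤n)) 6≤n }
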